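{- Let $G=(V,E)$ be a graph with $n$ vertices and $m$ edges and $\sigma$ an ordering of $V$. For each $i$, let $ln_i$ denote the position in $\sigma$ of the leftmost left neighbour of $\sigma(i)$ (i.e. $\min\{j<i : \sigma(j)\in N(\sigma(i))\}$), with $ln_i=-1$ if $\sigma(i)$ has no neighbour before it in $\sigma$. Consider the procedure GEN-check: set $J\leftarrow 1$; for $i=2,\dots,n$: if $ln_i=-1$ then $J\leftarrow i$, else if $ln_i<J$ then return "NO"; after the loop return "YES". Then GEN-check returns "YES" if and only if $\sigma$ is a GEN-ordering of $G$, and, given the values $ln_i$, it runs in $O(n)$ time. Moreover, whether $\sigma$ is a GEN-ordering of $G$ can be decided in $O(n+m)$ time.
   Context: $G$ is a finite (not necessarily connected) undirected graph; $N(v)$ is the set of neighbours of $v$. An ordering of $V$ is a bijection $\sigma:\{1,\dots,n\}\to V$, $\sigma(i)$ the $i$th vertex. $P_f(\mathbb{N}^+)$ is the set of finite subsets of positive integers. $\mathrm{TBLS}(G,\prec,\tau)$ (for a strict partial order $\prec$ on $P_f(\mathbb{N}^+)$ and ordering $\tau$ of $V$) is the procedure: set $label(v)=\emptyset$ for every $v$; for $i=1,\dots,n$: let Eligible be the set of unnumbered vertices $x$ such that there is no unnumbered vertex $y$ with $label(x)\prec label(y)$; let $v$ be the first vertex of Eligible in $\tau$; set $\sigma(i)=v$ ($v$ becomes numbered); for every unnumbered neighbour $w$ of $v$ replace $label(w)$ by $label(w)\cup\{i\}$; output $\sigma$. Define $A\prec_{gen}B$ iff $A=\emptyset$ and $B\neq\emptyset$.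 A GEN-ordering (generic search ordering) of $G$ is an ordering $\sigma=\mathrm{TBLS}(G,\prec_{gen},\tau)$ for some ordering $\tau$ of $V$. -}

module Defs where

open import Data.Bool.Base using (Bool; true; false; if_then_else_)
open import Data.Fin.Base as Fin using (Fin; toℕ)
import Data.Fin.Properties as Fin
open import Data.Fin.Permutation using (Permutation′; _⟨$⟩ʳ_)
open import Data.Integer.Base as ℤ using (ℤ; +_; -1ℤ; 0ℤ; 1ℤ)
import Data.Integer.Properties as ℤ
open import Data.List.Base using (List; []; _∷_; _∷ʳ_; allFin; cartesianProduct; filter; length; tabulate)
open import Data.List.Membership.Propositional using (_∈_; _∉_)
open import Data.List.Relation.Binary.BagAndSetEquality using (_∼[_]_; set; [_]-Equality; empty-unique)
open import Data.List.Relation.Unary.Unique.Propositional using (Unique)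
open import Data.Nat.Base as ℕ using (ℕ; zero; suc; NonZero)
import Data.Nat.Properties as ℕ
open import Data.Product.Base using (∃; _×_; _,_)
open import Function.Bundles using (_⇔_)
open import Function.Related.Propositional using (equivalence)
open import Level using (0ℓ)
open import Relation.Binary.Core using (Rel)
open import Relation.Binary.Bundles using (Setoid)
open import Relation.Binary.Definitions using (Decidable; Irreflexive; Symmetric)
open import Relation.Binary.PropositionalEquality.Core using (_≡_; _≢_; refl; sym; trans)
open import Relation.Binary.Structures using (IsStrictPartialOrder)
open import Relation.Nullary.Decidable using (Dec; yes; no; ⌊_⌋; ¬?; _×-dec_)
open import Relation.Nullary.Negation using (¬_)
import Data.List.Membership.DecPropositional as DecMembership

record Graph (n : ℕ) : Set₁ where
  field
    Adj        : Rel (Fin n) 0ℓ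
    adj?       : Decidable Adj
    adj-sym    : Symmetric Adj
    adj-irrefl : Irreflexive _≡_ Adj

∣E∣ : ∀ {n} → Graph n → ℕ
∣E∣ {n} G =
  length (filter (λ (u , v) → u Fin.<? v ×-dec Graph.adj? G u v)
                 (cartesianProduct (allFin n) (allFin n)))

-- σ ⟨$⟩ʳ i is the vertex in position suc (toℕ i).
Ordering : ℕ → Set
Ordering = Permutation′

ℕ⁺ : Set
ℕ⁺ = ∃ NonZero

-- Finite subsets of ℕ⁺: lists up to having the same members, _∼[ set ]_.
Label : Set
Label = List ℕ⁺

record LabelOrder : Set₁ where
  infix 4 _≺_ _≺?_
  field
    _≺_                  : Rel Label 0ℓ
    _≺?_                 : Decidable _≺_
    isStrictPartialOrder : IsStrictPartialOrder _∼[ set ]_ _≺_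

module _ {n} (G : Graph n) (O : LabelOrder) (τ : Ordering n) where
  open Graph G
  open LabelOrder O
  open DecMembership (Fin._≟_ {n}) using (_∉?_)

  -- The list of vertices is the list of numbered ones.
  Eligible : List (Fin n) → (Fin n → Label) → Fin n → Set
  Eligible numbered label x =
    x ∉ numbered × ¬ ∃ λ y → y ∉ numbered × label x ≺ label y

  eligible? : ∀ numbered label x → Dec (Eligible numbered label x)
  eligible? numbered label x =
    x ∉? numbered ×-dec
    ¬? (Fin.any? λ y → y ∉? numbered ×-dec label x ≺? label y)

  relabel : List (Fin n) → ℕ⁺ → Fin n → (Fin n → Label) → Fin n → Label
  relabel numbered i v label w =
    if ⌊ w ∉? numbered ×-dec adj? v w ⌋ then i ∷ label w else label w

  -- search k i numbered label makes the k iterations i, i+1, …, i+k-1.  It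
  -- would stop early with no eligible vertex, but a strict partial order has
  -- a maximal element among the labels of the unnumbered vertices.
  search : ℕ → ℕ⁺ → List (Fin n) → (Fin n → Label) → List (Fin n)
  search zero    _           numbered _     = numbered
  search (suc k) i@(i′ , _) numbered label
    with filter (eligible? numbered label) (tabulate (τ ⟨$⟩ʳ_))
  ... | []    = numbered
  ... | v ∷ _ = search k (suc i′ , _) (numbered ∷ʳ v)
                       (relabel (numbered ∷ʳ v) i v label)

  TBLS : List (Fin n)
  TBLS = search n (1 , _) [] (λ _ → [])

infix 4 _≺gen_ _≺gen?_

_≺gen_ : Rel Label 0ℓ
A ≺gen B = A ≡ [] × B ≢ []

_≺gen?_ : Decidable _≺gen_
A ≺gen? B = empty? A ×-dec ¬? (empty? B)
  where
  empty? : (C : Label) → Dec (C ≡ [])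
  empty? []      = yes refl
  empty? (_ ∷ _) = no λ ()

≺gen-isStrictPartialOrder : IsStrictPartialOrder _∼[ set ]_ _≺gen_
≺gen-isStrictPartialOrder = record
  { isEquivalence = Setoid.isEquivalence S
  ; irrefl        = λ { A∼B (refl , B≢[]) → B≢[] (empty (Setoid.sym S A∼B)) }
  ; trans         = λ { (A≡[] , _) (_ , C≢[]) → A≡[] , C≢[] }
  ; <-resp-≈      =
      (λ B∼C (A≡[] , B≢[]) →
        A≡[] , λ { refl → B≢[] (empty B∼C) })
    , (λ { A∼B (refl , C≢[]) → empty (Setoid.sym S A∼B) , C≢[] })
  }
  where
  S : Setoid 0ℓ 0ℓ
  S = [ set ]-Equality ℕ⁺
  empty : ∀ {A : Label} → A ∼[ set ] [] → A ≡ []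
  empty A∼[] = empty-unique {k = equivalence} A∼[]

gen : LabelOrder
gen = record { isStrictPartialOrder = ≺gen-isStrictPartialOrder ; _≺?_ = _≺gen?_ }

IsGENOrdering : ∀ {n} → Graph n → Ordering n → Set
IsGENOrdering G σ = ∃ λ τ → TBLS G gen τ ≡ tabulate (σ ⟨$⟩ʳ_)

-- Vertices and positions are counted from 1.
num : ∀ {n} → Fin n → ℤ
num i = + suc (toℕ i)

-- allFin n is increasing, so the first element of the filtered list is the
-- least.
ln : ∀ {n} → Graph n → Ordering n → Fin n → ℤ
ln {n} G σ i
  with filter (λ j → j Fin.<? i ×-dec Graph.adj? G (σ ⟨$⟩ʳ i) (σ ⟨$⟩ʳ j)) (allFin n)
... | []    = -1ℤ
... | j ∷ _ = num j

-- Programs run on a random access machine with named integer variables and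
-- named arrays.  The only arithmetic is the addition of a constant of the
-- program, so a run of length t exceeds the largest number in the input by
-- O(t) at most, and charging unit cost for every operation is not an abuse.

Name : Set
Name = ℕ

infix  9 _⟦_⟧
infixl 8 _⊕_
infix  7 _==_ _≤ᵉ_ _<ᵉ_ _:=_ _⟦_⟧:=_
infixr 6 IF_THEN_ELSE_ WHILE_DO_
infixr 5 _⨾_

data Exp : Set where
  lit  : ℤ → Exp
  var  : Name → Exp
  _⟦_⟧ : Name → Exp → Exp
  _⊕_  : Exp → ℤ → Exp

data Test : Set where
  _==_ _≤ᵉ_ _<ᵉ_ : Exp → Exp → Test

data Program : Set where
  skip            : Program
  _:=_            : Name → Exp → Program
  _⟦_⟧:=_         : Name → Exp → Exp → Program
  _⨾_             : Program → Program → Program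
  IF_THEN_ELSE_   : Test → Program → Program → Program
  WHILE_DO_       : Test → Program → Program
  RETURN          : Bool → Program

record State : Set where
  constructor ⟨_,_⟩
  field
    scalar : Name → ℤ
    array  : Name → ℤ → ℤ
open State public

setScalar : Name → ℤ → State → State
setScalar x k s = record s
  { scalar = λ y → if ⌊ y ℕ.≟ x ⌋ then k else scalar s y }

setCell : Name → ℤ → ℤ → State → State
setCell a j k s = record s
  { array = λ b i → if ⌊ b ℕ.≟ a ×-dec i ℤ.≟ j ⌋ then k else array s b i }

eval : State → Exp → ℤ
eval s (lit k)   = k
eval s (var x)   = scalar s x
eval s (a ⟦ e ⟧) = array s a (eval s e)
eval s (e ⊕ k)   = eval s e ℤ.+ k

test : State → Test → Bool
test s (e == f) = ⌊ eval s e ℤ.≟ eval s f ⌋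
test s (e ≤ᵉ f) = ⌊ eval s e ℤ.≤? eval s f ⌋
test s (e <ᵉ f) = ⌊ eval s e ℤ.<? eval s f ⌋

expCost : Exp → ℕ
expCost (lit _)   = 1
expCost (var _)   = 1
expCost (_ ⟦ e ⟧) = suc (expCost e)
expCost (e ⊕ _)   = suc (expCost e)

testCost : Test → ℕ
testCost (e == f) = suc (expCost e ℕ.+ expCost f)
testCost (e ≤ᵉ f) = suc (expCost e ℕ.+ expCost f)
testCost (e <ᵉ f) = suc (expCost e ℕ.+ expCost f)

data Outcome : Set where
  running  : State → Outcome
  returned : Bool → Outcome

-- P , s ⇓ o , t : started in state s, the program P ends with outcome o after
-- t units of time.
infix 4 _,_⇓_,_

data _,_⇓_,_ : Program → State → Outcome → ℕ → Set where
  skip    : ∀ {s} → skip , s ⇓ running s , 1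
  assign  : ∀ {s x e} →
            x := e , s ⇓ running (setScalar x (eval s e) s) , suc (expCost e)
  ret     : ∀ {s b} → RETURN b , s ⇓ returned b , 1
  store   : ∀ {s a e f} →
            a ⟦ e ⟧:= f , s ⇓ running (setCell a (eval s e) (eval s f) s) ,
              suc (expCost e ℕ.+ expCost f)
  seq     : ∀ {P Q s s′ o t u} →
            P , s ⇓ running s′ , t → Q , s′ ⇓ o , u →
            P ⨾ Q , s ⇓ o , t ℕ.+ u
  seqRet  : ∀ {P Q s b t} →
            P , s ⇓ returned b , t →
            P ⨾ Q , s ⇓ returned b , t
  ifTrue  : ∀ {c P Q s o t} →
            test s c ≡ true → P , s ⇓ o , t →
            IF c THEN P ELSE Q , s ⇓ o , testCost c ℕ.+ t
  ifFalse : ∀ {c P Q s o t} →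
            test s c ≡ false → Q , s ⇓ o , t →
            IF c THEN P ELSE Q , s ⇓ o , testCost c ℕ.+ t
  stop    : ∀ {c P s} →
            test s c ≡ false →
            WHILE c DO P , s ⇓ running s , testCost c
  loop    : ∀ {c P s s′ o t u} →
            test s c ≡ true → P , s ⇓ running s′ , t →
            WHILE c DO P , s′ ⇓ o , u →
            WHILE c DO P , s ⇓ o , testCost c ℕ.+ t ℕ.+ u
  loopRet : ∀ {c P s b t} →
            test s c ≡ true → P , s ⇓ returned b , t →
            WHILE c DO P , s ⇓ returned b , testCost c ℕ.+ t

⇓-deterministic : ∀ {P s o o′ t t′} → P , s ⇓ o , t → P , s ⇓ o′ , t′ → o ≡ o′ × t ≡ t′
⇓-deterministic skip skip = refl , refl
⇓-deterministic assign assign = refl , refl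
⇓-deterministic store store = refl , refl
⇓-deterministic ret ret = refl , refl
⇓-deterministic (seq a b) (seq c d)
  with refl , refl ← ⇓-deterministic a c
  with refl , refl ← ⇓-deterministic b d
  = refl , refl
⇓-deterministic (seq a b) (seqRet c) with () , _ ← ⇓-deterministic a c
⇓-deterministic (seqRet a) (seq c d) with () , _ ← ⇓-deterministic a c
⇓-deterministic (seqRet a) (seqRet c) with refl , refl ← ⇓-deterministic a c = refl , refl
⇓-deterministic (ifTrue p a) (ifTrue q c) with refl , refl ← ⇓-deterministic a c = refl , refl
⇓-deterministic (ifTrue p a) (ifFalse q c) with () ← trans (sym p) q
⇓-deterministic (ifFalse p a) (ifTrue q c) with () ← trans (sym p) q
⇓-deterministic (ifFalse p a) (ifFalse q c)
  with refl , refl ← ⇓-deterministic a c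
  = refl , refl
⇓-deterministic (stop p) (stop q) = refl , refl
⇓-deterministic (stop p) (loop q _ _) with () ← trans (sym p) q
⇓-deterministic (stop p) (loopRet q _) with () ← trans (sym p) q
⇓-deterministic (loop p _ _) (stop q) with () ← trans (sym p) q
⇓-deterministic (loopRet p _) (stop q) with () ← trans (sym p) q
⇓-deterministic (loop _ a b) (loop _ c d)
  with refl , refl ← ⇓-deterministic a c
  with refl , refl ← ⇓-deterministic b d
  = refl , refl
⇓-deterministic (loop _ a b) (loopRet _ c) with () , _ ← ⇓-deterministic a c
⇓-deterministic (loopRet _ a) (loop _ c d) with () , _ ← ⇓-deterministic a c
⇓-deterministic (loopRet _ a) (loopRet _ c)
  with refl , refl ← ⇓-deterministic a c
  = refl , refl

-- From state s the program returns true (YES) or false (NO) according to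
-- whether A holds, in time at most c * size.  The guard is for the empty
-- graph, where size = 0.
record Decides (P : Program) (s : State) (A : Set) (c size : ℕ) : Set where
  field
    answer  : Bool
    time    : ℕ
    run     : P , s ⇓ returned answer , time
    correct : answer ≡ true ⇔ A
    bound   : 1 ℕ.≤ size → time ℕ.≤ c ℕ.* size

pattern N = 0
pattern I = 1
pattern J = 2

pattern LN = 0

GEN-check : Program
GEN-check =
  J := lit 1ℤ ⨾
  I := lit (+ 2) ⨾
  WHILE var I ≤ᵉ var N DO (
    IF LN ⟦ var I ⟧ == lit -1ℤ
      THEN J := var I
      ELSE IF LN ⟦ var I ⟧ <ᵉ var J
        THEN RETURN false
        ELSE skip ⨾
    I := var I ⊕ 1ℤ) ⨾
  RETURN true

-- Variables and cells that these predicates do not mention are arbitrary, so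
-- a program cannot rely on initialised memory.

HoldsSize : ℕ → State → Set
HoldsSize n s = scalar s N ≡ + n

HoldsLn : ∀ {n} → Graph n → Ordering n → State → Set
HoldsLn G σ s = ∀ i → array s LN (num i) ≡ ln G σ i

pattern ORDER = 1
pattern HEAD  = 2
pattern VERT  = 3
pattern NEXT  = 4

HoldsOrdering : ∀ {n} → Ordering n → State → Set
HoldsOrdering σ s = ∀ i → array s ORDER (num i) ≡ num (σ ⟨$⟩ʳ i)

-- The linked list starting at a pointer; the pointer 0 is nil.
data Linked {n} (s : State) : ℤ → List (Fin n) → Set where
  []  : Linked s 0ℤ []
  _∷_ : ∀ {p v vs} →
        p ≢ 0ℤ × array s VERT p ≡ num v →
        Linked s (array s NEXT p) vs →
        Linked s p (v ∷ vs)

-- Adjacency lists: HEAD leads from a vertex to the linked list of its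
-- neighbours, which come in any order but only once each.
HoldsGraph : ∀ {n} → Graph n → State → Set
HoldsGraph {n} G s = ∀ v → ∃ λ vs →
  Unique vs × (∀ w → w ∈ vs ⇔ Graph.Adj G v w) × Linked s (array s HEAD (num v)) vs

-- A generic search may number v next exactly if v has a numbered neighbour, or
-- no unnumbered vertex has one.  Hence σ is a GEN-ordering iff every vertex
-- satisfies this when its turn in σ comes, and then the search with τ = σ
-- outputs σ itself.  In terms of ln: no ln c other than -1 lies before a
-- position b < c with ln b = -1.  It is enough to compare ln c with the last such b,
-- which is the J of GEN-check.
--
-- To decide the property from adjacency lists, invert σ, compute every ln by
-- walking through the list of the vertex, and run GEN-check.  The lists have
-- total length at most 2m, as each entry is an arc of G and no arc occurs twice.
module Submission where

open import Defs
open import Data.Bool.Base using (Bool; true; false)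
open import Data.Empty using (⊥)
open import Data.Fin.Base as Fin using (Fin; toℕ)
open import Data.Fin.Permutation using (_⟨$⟩ʳ_; _⟨$⟩ˡ_; inverseˡ; inverseʳ)
import Data.Fin.Properties as Fin
open import Data.Integer.Base as ℤ using (ℤ; +_; -1ℤ; 0ℤ; 1ℤ)
import Data.Integer.Properties as ℤ
open import Data.List.Base
  using (List; []; _∷_; _++_; _∷ʳ_; allFin; cartesianProduct; concat; filter; length;
         map; tabulate)
import Data.List.Membership.DecPropositional as DecMembership
open import Data.List.Membership.Propositional using (_∈_; _∉_)
open import Data.List.Membership.Propositional.Properties
import Data.List.Properties as List
open import Data.List.Relation.Binary.Subset.Propositional using (_⊆_)
open import Data.List.Relation.Unary.All as All using ([]; _∷_)
import Data.List.Relation.Unary.All.Properties as All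
open import Data.List.Relation.Unary.AllPairs using ([]; _∷_)
import Data.List.Relation.Unary.AllPairs.Properties as AllPairs
open import Data.List.Relation.Unary.Any using (here; there)
open import Data.List.Relation.Unary.Unique.Propositional using (Unique)
import Data.List.Relation.Unary.Unique.Propositional.Properties as Unique
open import Data.Nat.Base as ℕ using (ℕ; zero; suc; _+_; _*_; _≤_; _<_; z≤n; s≤s)
open import Data.Nat.ListAction using (sum)
import Data.Nat.Properties as ℕ
open import Data.Nat.Solver using (module +-*-Solver)
open import Data.Product.Base using (∃; ∃₂; _×_; _,_; proj₁; proj₂; swap)
open import Data.Sum.Base using (_⊎_; inj₁; inj₂)
open import Function.Base using (_∘_; id; case_of_)
open import Function.Bundles using (_⇔_; mk⇔; module Equivalence)
open import Relation.Binary.Definitions using (tri<; tri≈; tri>)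
open import Relation.Binary.PropositionalEquality
  using (_≡_; _≢_; refl; sym; trans; cong; cong₂; cong-app; subst; subst₂)
open import Relation.Nullary.Decidable using (Dec; yes; no; ⌊_⌋; _×-dec_)
open import Relation.Nullary.Negation using (¬_; contradiction)
open import Relation.Unary using (Decidable)
open Equivalence using (to; from)

-- Generic searches

-- This is the tie-breaking rule of the search: the head of the filtered list is the vertex that
-- gets numbered.
filter-tabulate : ∀ {A : Set} {P : A → Set} (P? : Decidable P) {n} (f : Fin n → A) j →
                  P (f j) → (∀ i → i Fin.< j → ¬ P (f i)) →
                  ∃ λ ys → filter P? (tabulate f) ≡ f j ∷ ys
filter-tabulate P? f Fin.zero    pj ¬pi = _ , List.filter-accept P? pj
filter-tabulate P? f (Fin.suc j) pj ¬pi
  with ys , eq ← filter-tabulate P? (f ∘ Fin.suc) j pj (λ i i<j → ¬pi (Fin.suc i) (s≤s i<j))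
  = ys , trans (List.filter-reject P? (¬pi Fin.zero (s≤s z≤n))) eq

module _ {n} (G : Graph n) where
  open Graph G

  -- Vertices are only ever appended. Comparing the output with a prescribed list therefore reveals
  -- the vertex chosen in each iteration.
  search-extends : ∀ τ r i numbered label →
                   ∃ λ rest → search G gen τ r i numbered label ≡ numbered ++ rest
  search-extends τ zero    i numbered label = [] , sym (List.++-identityʳ numbered)
  search-extends τ (suc r) i numbered label
    with filter (eligible? G gen τ numbered label) (tabulate (τ ⟨$⟩ʳ_))
  ... | []    = [] , sym (List.++-identityʳ numbered)
  ... | v ∷ _
    with rest , eq ← search-extends τ r (suc (proj₁ i) , _) (numbered ∷ʳ v)
                                    (relabel G gen τ (numbered ∷ʳ v) i v label)
    = v ∷ rest , trans eq (List.∷ʳ-++ numbered v rest)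

  -- All that `_≺gen_` sees of a label is whether it is empty, so the invariant does not record
  -- which numbers a label contains. It is restricted to unnumbered vertices because only their
  -- labels are kept up to date.
  Labels : List (Fin n) → (Fin n → Label) → Set
  Labels numbered label = ∀ w → w ∉ numbered → label w ≢ [] ⇔ ∃ λ u → u ∈ numbered × Adj u w

  relabel-Labels : ∀ {τ numbered label i} v → Labels numbered label →
                   Labels (numbered ∷ʳ v) (relabel G gen τ (numbered ∷ʳ v) i v label)
  relabel-Labels {τ} {numbered} {label} {i} v labels w w∉ = mk⇔ fwd bwd
    where
    open DecMembership (Fin._≟_ {n}) using (_∉?_)
    fwd : relabel G gen τ (numbered ∷ʳ v) i v label w ≢ [] → ∃ λ u → u ∈ numbered ∷ʳ v × Adj u w
    fwd ≢[] with w ∉? (numbered ∷ʳ v) ×-dec adj? v w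
    ... | yes (_ , vw) = v , ∈-++⁺ʳ numbered (here refl) , vw
    ... | no _ with u , u∈ , uw ← labels w (w∉ ∘ ∈-++⁺ˡ) .to ≢[] = u , ∈-++⁺ˡ u∈ , uw
    bwd : (∃ λ u → u ∈ numbered ∷ʳ v × Adj u w) → relabel G gen τ (numbered ∷ʳ v) i v label w ≢ []
    bwd (u , u∈ , uw) with w ∉? (numbered ∷ʳ v) ×-dec adj? v w | ∈-++⁻ numbered u∈
    ... | yes _ | _                = λ ()
    ... | no  _ | inj₁ u∈′         = labels w (w∉ ∘ ∈-++⁺ˡ) .from (u , u∈′ , uw)
    ... | no ¬p | inj₂ (here refl) = contradiction (w∉ , uw) ¬p

  module _ (σ : Ordering n) where

    pos : Fin n → ℕ
    pos v = toℕ (σ ⟨$⟩ˡ v)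

    pos-σ : ∀ i → pos (σ ⟨$⟩ʳ i) ≡ toℕ i
    pos-σ i = cong toℕ (inverseˡ σ)

    pos-injective : ∀ {u v} → pos u ≡ pos v → u ≡ v
    pos-injective eq =
      trans (sym (inverseʳ σ)) (trans (cong (σ ⟨$⟩ʳ_) (Fin.toℕ-injective eq)) (inverseʳ σ))

    -- Eligibility of `v` at the moment when exactly the vertices before it in `σ` are numbered,
    -- freed of labels and lists. The second alternative says that no edge leaves the set of
    -- numbered vertices.
    Choosable : Fin n → Set
    Choosable v = (∃ λ u → pos u < pos v × Adj u v)
                ⊎ (∀ {u w} → pos u < pos v → pos v ≤ pos w → ¬ Adj u w)

    Prefix : ℕ → List (Fin n) → Set
    Prefix k numbered = ∀ u → u ∈ numbered ⇔ pos u < k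

    prefix-∷ʳ : ∀ {k numbered v} → Prefix k numbered → pos v ≡ k → Prefix (suc k) (numbered ∷ʳ v)
    prefix-∷ʳ {k} {numbered} {v} prefix refl u = mk⇔ fwd bwd
      where
      fwd : u ∈ numbered ∷ʳ v → pos u < suc (pos v)
      fwd u∈ with ∈-++⁻ numbered u∈
      ... | inj₁ u∈′         = ℕ.m<n⇒m<1+n (prefix u .to u∈′)
      ... | inj₂ (here refl) = ℕ.≤-refl
      bwd : pos u < suc (pos v) → u ∈ numbered ∷ʳ v
      bwd u≤v with ℕ.m≤n⇒m<n∨m≡n (ℕ.≤-pred u≤v)
      ... | inj₁ u<v = ∈-++⁺ˡ (prefix u .from u<v)
      ... | inj₂ u≡v = ∈-++⁺ʳ numbered (here (pos-injective u≡v))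

    prefix-∉ : ∀ {k numbered u} → Prefix k numbered → u ∉ numbered → k ≤ pos u
    prefix-∉ prefix u∉ = ℕ.≮⇒≥ (u∉ ∘ prefix _ .from)

    -- A nonempty label comes from a numbered neighbour. If the label of `v` is empty, maximality
    -- forbids a nonempty label at any unnumbered vertex, and hence any edge from a numbered to an
    -- unnumbered vertex.
    eligible⇒choosable : ∀ {τ k numbered label v} → Prefix k numbered → Labels numbered label →
                         pos v ≡ k → Eligible G gen τ numbered label v → Choosable v
    eligible⇒choosable {label = label} {v} prefix labels refl (v∉ , maximal)
      with label v in eq
    ... | _ ∷ _ with u , u∈ , uv ← labels v v∉ .to (λ p → case trans (sym eq) p of λ ())
      = inj₁ (u , prefix u .to u∈ , uv)
    ... | [] = inj₂ λ {u} {w} u<v v≤w uw →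
      let w∉ = λ w∈ → ℕ.<⇒≱ (prefix w .to w∈) v≤w
      in maximal (w , w∉ , refl , labels w w∉ .from (u , prefix u .from u<v , uw))

    -- A nonempty label is below no other. If no edge leaves the numbered vertices, all unnumbered
    -- labels are empty and none lies above that of `v`.
    choosable⇒eligible : ∀ {τ k numbered label v} → Prefix k numbered → Labels numbered label →
                         pos v ≡ k → Choosable v → Eligible G gen τ numbered label v
    choosable⇒eligible {v = v} prefix labels refl choosable = v∉ , maximal choosable
      where
      v∉ = λ v∈ → ℕ.<-irrefl refl (prefix v .to v∈)
      maximal : Choosable v → ¬ ∃ λ y → y ∉ _ × _ ≺gen _
      maximal (inj₁ (u , u<v , uv)) (_ , _ , v≡[] , _) =
        labels v v∉ .from (u , prefix u .from u<v , uv) v≡[]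
      maximal (inj₂ ∄adj) (y , y∉ , _ , y≢[])
        with u , u∈ , uy ← labels y y∉ .to y≢[]
        = ∄adj (prefix u .to u∈) (prefix-∉ prefix y∉) uy

    pos-tail : ∀ {r k} {f : Fin (suc r) → Fin n} → (∀ b → pos (f b) ≡ k + toℕ b) →
               ∀ b → pos (f (Fin.suc b)) ≡ suc k + toℕ b
    pos-tail {k = k} pos-f b = trans (pos-f (Fin.suc b)) (ℕ.+-suc k (toℕ b))

    -- Induction on the number `r` of iterations left, where `f` lists the vertices of `σ` from
    -- position `k` on.
    search⇒choosable : ∀ τ r {k i numbered label} (f : Fin r → Fin n) →
                       Prefix k numbered → (∀ b → pos (f b) ≡ k + toℕ b) → Labels numbered label →
                       search G gen τ r i numbered label ≡ numbered ++ tabulate f →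
                       ∀ b → Choosable (f b)
    search⇒choosable τ (suc r) {k} {i} {numbered} {label} f prefix pos-f labels eq
      with filter (eligible? G gen τ numbered label) (tabulate (τ ⟨$⟩ʳ_)) in chosen
    -- Stopping here would leave out `f Fin.zero`, against the prescribed output.
    ... | [] with () ← List.++-cancelˡ numbered [] _ (trans (List.++-identityʳ numbered) eq)
    ... | v ∷ _
      with rest , eq′ ← search-extends τ r (suc (proj₁ i) , _) (numbered ∷ʳ v)
                                       (relabel G gen τ (numbered ∷ʳ v) i v label)
      -- After `numbered`, the output continues with `v` and the prescribed list with `f Fin.zero`,
      -- so the two vertices agree.
      with refl , _ ← List.∷-injective (List.++-cancelˡ numbered (v ∷ rest) (tabulate f)
                        (trans (sym (List.∷ʳ-++ numbered v rest)) (trans (sym eq′) eq)))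
      = λ where
        Fin.zero    → eligible⇒choosable {τ} prefix labels pos-v
                        (proj₂ (∈-filter⁻ (eligible? G gen τ numbered label) {xs = tabulate (τ ⟨$⟩ʳ_)}
                          (subst (v ∈_) (sym chosen) (here refl))))
        (Fin.suc b) → search⇒choosable τ r (f ∘ Fin.suc) (prefix-∷ʳ prefix pos-v)
                        (pos-tail pos-f) (relabel-Labels {τ} v labels)
                        (trans eq (sym (List.∷ʳ-++ numbered v _))) b
      where
      pos-v : pos (f Fin.zero) ≡ k
      pos-v = trans (pos-f Fin.zero) (ℕ.+-identityʳ k)

    -- Ties are broken by `σ` itself here: everything before `v` in `σ` is already numbered, so `v`
    -- is the first eligible vertex.
    chosen-next : (∀ v → Choosable v) →
                  ∀ {k numbered label v} → Prefix k numbered → Labels numbered label → pos v ≡ k →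
                  ∃ λ ys → filter (eligible? G gen σ numbered label) (tabulate (σ ⟨$⟩ʳ_)) ≡ v ∷ ys
    chosen-next choosable {k} {numbered} {label} {v} prefix labels pos-v
      with ys , eq ← filter-tabulate (eligible? G gen σ numbered label) (σ ⟨$⟩ʳ_) (σ ⟨$⟩ˡ v)
             (subst (Eligible G gen σ numbered label) (sym (inverseʳ σ))
               (choosable⇒eligible {σ} prefix labels pos-v (choosable v)))
             (λ j j<v (j∉ , _) → j∉ (prefix _ .from (subst₂ _<_ (sym (pos-σ j)) pos-v j<v)))
      = ys , trans eq (cong (_∷ ys) (inverseʳ σ))

    choosable⇒search : (∀ v → Choosable v) →
                       ∀ r {k i numbered label} (f : Fin r → Fin n) →
                       Prefix k numbered → (∀ b → pos (f b) ≡ k + toℕ b) → Labels numbered label →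
                       search G gen σ r i numbered label ≡ numbered ++ tabulate f
    choosable⇒search choosable zero {numbered = numbered} f prefix pos-f labels =
      sym (List.++-identityʳ numbered)
    choosable⇒search choosable (suc r) {k} {i} {numbered} {label} f prefix pos-f labels
      with pos-v ← trans (pos-f Fin.zero) (ℕ.+-identityʳ k)
      with filter (eligible? G gen σ numbered label) (tabulate (σ ⟨$⟩ʳ_))
         | chosen-next choosable {v = f Fin.zero} prefix labels pos-v
    ... | _ | _ , refl =
      trans (choosable⇒search choosable r (f ∘ Fin.suc)
              (prefix-∷ʳ prefix pos-v) (pos-tail pos-f) (relabel-Labels {σ} (f Fin.zero) labels))
            (List.∷ʳ-++ numbered (f Fin.zero) _)

    prefix-[] : Prefix 0 []
    prefix-[] u = mk⇔ (λ ()) (λ ())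

    labels-[] : Labels [] (λ _ → [])
    labels-[] w _ = mk⇔ (λ ≢[] → contradiction refl ≢[]) (λ ())

    IsGENOrdering⇔Choosable : IsGENOrdering G σ ⇔ (∀ v → Choosable v)
    IsGENOrdering⇔Choosable = mk⇔
      (λ (τ , eq) v → subst Choosable (inverseʳ σ)
        (search⇒choosable τ n (σ ⟨$⟩ʳ_) prefix-[] pos-σ labels-[] eq (σ ⟨$⟩ˡ v)))
      (λ choosable → σ , choosable⇒search choosable n (σ ⟨$⟩ʳ_) prefix-[] pos-σ labels-[])

    -- Leftmost left neighbours

    LeftNeighbour : Fin n → Fin n → Set
    LeftNeighbour i j = j Fin.< i × Adj (σ ⟨$⟩ʳ i) (σ ⟨$⟩ʳ j)

    -- A specification of `ln` free of the filtered list. Since it determines the value, a number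
    -- obtained by a program can be identified with `ln` by checking these conditions.
    data IsLn (i : Fin n) (x : ℤ) : Set where
      none  : x ≡ -1ℤ → (∀ j → ¬ LeftNeighbour i j) → IsLn i x
      least : ∀ j → x ≡ num j → LeftNeighbour i j → (∀ k → LeftNeighbour i k → j Fin.≤ k) → IsLn i x

    ln-IsLn : ∀ i → IsLn i (ln G σ i)
    ln-IsLn i
      -- Filtering keeps `allFin n` strictly increasing, so the head of the list is the least
      -- element. Completeness and soundness are abstracted together with the list, to be refined
      -- when it is split.
      with filter (λ j → j Fin.<? i ×-dec adj? (σ ⟨$⟩ʳ i) (σ ⟨$⟩ʳ j)) (allFin n)
         | (λ k → ∈-filter⁺ (λ j → j Fin.<? i ×-dec adj? (σ ⟨$⟩ʳ i) (σ ⟨$⟩ʳ j)) (∈-allFin k))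
         | (λ k → ∈-filter⁻ (λ j → j Fin.<? i ×-dec adj? (σ ⟨$⟩ʳ i) (σ ⟨$⟩ʳ j)) {v = k} {xs = allFin n})
         | AllPairs.filter⁺ (λ j → j Fin.<? i ×-dec adj? (σ ⟨$⟩ʳ i) (σ ⟨$⟩ʳ j))
             (AllPairs.tabulate⁺-< {R = Fin._<_} {f = id} id)
    ... | []    | complete | sound | _ = none refl λ j p → case complete j p of λ ()
    ... | j ∷ _ | complete | sound | j<js ∷ _ = least j refl (proj₂ (sound j (here refl))) minimal
      where
      minimal : ∀ k → LeftNeighbour i k → j Fin.≤ k
      minimal k p with complete k p
      ... | here refl = ℕ.≤-refl
      ... | there k∈  = ℕ.<⇒≤ (All.lookup j<js k∈)

    IsLn-unique : ∀ {i x y} → IsLn i x → IsLn i y → x ≡ y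
    IsLn-unique (none p _) (none q _) = trans p (sym q)
    IsLn-unique (none _ ∄) (least j _ j∈ _) = contradiction j∈ (∄ j)
    IsLn-unique (least j _ j∈ _) (none _ ∄) = contradiction j∈ (∄ j)
    IsLn-unique (least j p j∈ j≤) (least k q k∈ k≤) =
      trans p (trans (cong num (Fin.≤-antisym (j≤ k k∈) (k≤ j j∈))) (sym q))

-- Stated for an arbitrary sequence, so that the loop of `GEN-check` can be verified without graphs.
-- It quantifies over every earlier `b` with value -1, not only the last one.
Accepts : ∀ {n} → (Fin n → ℤ) → Set
Accepts L = ∀ b c → b Fin.< c → L b ≡ -1ℤ → L c ≢ -1ℤ → num b ℤ.≤ L c

module _ {n} (G : Graph n) (σ : Ordering n) where
  open Graph G

  private
    -- A leftmost left neighbour of `b` is a numbered neighbour. If there is none, consider an edge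
    -- from a position `a` before `b` to a position `c` not before `b`: `c = b` would give `b` a
    -- left neighbour, and a later `c` would have its leftmost left neighbour at or before `a`, so
    -- before `b`.
    choosable : ∀ {b} → Accepts (ln G σ) → IsLn G σ b (ln G σ b) → Choosable G σ (σ ⟨$⟩ʳ b)
    choosable {b} accepts (least j _ (j<b , bj) _) =
      inj₁ (σ ⟨$⟩ʳ j , subst₂ _<_ (sym (pos-σ G σ j)) (sym (pos-σ G σ b)) j<b , adj-sym bj)
    choosable {b} accepts (none lnb ∄) = inj₂ refute
      where
      refute : ∀ {u w} → pos G σ u < pos G σ (σ ⟨$⟩ʳ b) → pos G σ (σ ⟨$⟩ʳ b) ≤ pos G σ w → ¬ Adj u w
      refute {u} {w} u<b b≤w uw = absurd (ℕ.m≤n⇒m<n∨m≡n (subst (_≤ _) (pos-σ G σ b) b≤w))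
        where
        a = σ ⟨$⟩ˡ u
        c = σ ⟨$⟩ˡ w
        a<b : a Fin.< b
        a<b = subst (_ <_) (pos-σ G σ b) u<b
        ca : Adj (σ ⟨$⟩ʳ c) (σ ⟨$⟩ʳ a)
        ca = subst₂ Adj (sym (inverseʳ σ)) (sym (inverseʳ σ)) (adj-sym uw)
        absurd : ¬ (b Fin.< c ⊎ toℕ b ≡ toℕ c)
        absurd (inj₂ b≡c) with refl ← Fin.toℕ-injective b≡c = ∄ a (a<b , ca)
        absurd (inj₁ b<c) with ln-IsLn G σ c
        ... | none _ ∄c = ∄c a (ℕ.<-trans a<b b<c , ca)
        ... | least j lnc _ j≤ with accepts b c b<c lnb (λ lnc′ → case trans (sym lnc) lnc′ of λ ())
        ... | b≤ln with ℤ.+≤+ (s≤s b≤j) ← subst (num b ℤ.≤_) lnc b≤ln =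
          ℕ.<⇒≱ (ℕ.<-≤-trans a<b b≤j) (j≤ a (ℕ.<-trans a<b b<c , ca))

    -- As `b` has no left neighbour, only the second alternative of `Choosable` remains for it. That
    -- one excludes an edge from a position `j` before `b` to the later position `c`.
    accepts : (∀ v → Choosable G σ v) → Accepts (ln G σ)
    accepts choosable b c b<c lnb lnc with ln-IsLn G σ b | ln-IsLn G σ c
    ... | least _ lnb′ _ _ | _           = case trans (sym lnb) lnb′ of λ ()
    ... | none _ _        | none lnc′ _ = contradiction lnc′ lnc
    ... | none _ ∄        | least j lnc′ (j<c , cj) _ =
      subst (num b ℤ.≤_) (sym lnc′) (ℤ.+≤+ (s≤s (ℕ.≮⇒≥ (j≮b (choosable (σ ⟨$⟩ʳ b))))))
      where
      j≮b : Choosable G σ (σ ⟨$⟩ʳ b) → ¬ j Fin.< b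
      j≮b (inj₁ (u , u<b , ub)) _ =
        ∄ (σ ⟨$⟩ˡ u) (subst (_ <_) (pos-σ G σ b) u<b ,
                      subst (Adj _) (sym (inverseʳ σ)) (adj-sym ub))
      j≮b (inj₂ ∄adj) j<b =
        ∄adj (subst₂ _<_ (sym (pos-σ G σ j)) (sym (pos-σ G σ b)) j<b)
             (subst₂ _≤_ (sym (pos-σ G σ b)) (sym (pos-σ G σ c)) (ℕ.<⇒≤ b<c))
             (adj-sym cj)

  IsGENOrdering⇔Accepts : IsGENOrdering G σ ⇔ Accepts (ln G σ)
  IsGENOrdering⇔Accepts = mk⇔
    (accepts ∘ IsGENOrdering⇔Choosable G σ .to)
    (λ acc → IsGENOrdering⇔Choosable G σ .from λ v →
      subst (Choosable G σ) (inverseʳ σ) (choosable acc (ln-IsLn G σ (σ ⟨$⟩ˡ v))))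

-- Counting arcs

-- Pigeonhole principle: deleting one occurrence of `x` from `ys` loses none of the remaining
-- elements of `xs`, as they all differ from `x`.
unique-⊆-length : ∀ {A : Set} {xs ys : List A} → Unique xs → xs ⊆ ys → length xs ≤ length ys
unique-⊆-length [] _ = z≤n
unique-⊆-length {xs = x ∷ xs} (x∉xs ∷ unique) xs⊆ys
  with as , bs , refl ← ∈-∃++ (xs⊆ys (here refl))
  = subst (suc (length xs) ≤_) (sym (List.length-++-sucʳ as x bs))
          (s≤s (unique-⊆-length unique λ y∈ →
            drop-x (All.lookup x∉xs y∈) (∈-++⁻ as (xs⊆ys (there y∈)))))
  where
  drop-x : ∀ {y} → x ≢ y → y ∈ as ⊎ y ∈ x ∷ bs → y ∈ as ++ bs
  drop-x x≢y (inj₁ y∈)          = ∈-++⁺ˡ y∈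
  drop-x x≢y (inj₂ (here refl)) = contradiction refl x≢y
  drop-x x≢y (inj₂ (there y∈))  = ∈-++⁺ʳ as y∈

-- Totals the cost of a loop over the vertices that spends a constant on each vertex and on each
-- entry of its list.
sum-tabulate-affine : ∀ {A : Set} {n} (f : Fin n → List A) a b →
  sum (tabulate λ i → a + b * length (f i)) ≡ a * n + b * length (concat (tabulate f))
sum-tabulate-affine {n = zero}  f a b = sym (cong₂ _+_ (ℕ.*-zeroʳ a) (ℕ.*-zeroʳ b))
sum-tabulate-affine {n = suc n} f a b
  rewrite sum-tabulate-affine (f ∘ Fin.suc) a b
        | List.length-++ (f Fin.zero) {concat (tabulate (f ∘ Fin.suc))}
  = solve 5 (λ a b x n y → a :+ b :* x :+ (a :* n :+ b :* y)
                              := a :* (con 1 :+ n) :+ b :* (x :+ y)) refl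
      a b (length (f Fin.zero)) n (length (concat (tabulate (f ∘ Fin.suc))))
  where open +-*-Solver

length-concat-map : ∀ {A B : Set} {n} (g : Fin n → A → B) (f : Fin n → List A) →
  length (concat (tabulate λ i → map (g i) (f i))) ≡ length (concat (tabulate f))
length-concat-map {n = zero}  g f = refl
length-concat-map {n = suc n} g f =
  trans (List.length-++ (map (g Fin.zero) (f Fin.zero)))
    (trans (cong₂ _+_ (List.length-map (g Fin.zero) (f Fin.zero))
                      (length-concat-map (g ∘ Fin.suc) (f ∘ Fin.suc)))
      (sym (List.length-++ (f Fin.zero))))

module _ {n} (G : Graph n) where
  open Graph G

  -- The handshake bound: the arcs are pairwise distinct, and each is a counted edge or the reversal
  -- of one, since `∣E∣` counts an edge with its smaller end first.
  degree-sum≤ : (nb : Fin n → List (Fin n)) → (∀ v → Unique (nb v)) →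
                (∀ {v w} → w ∈ nb v → Adj v w) →
                length (concat (tabulate nb)) ≤ ∣E∣ G + ∣E∣ G
  degree-sum≤ nb unique adj = begin
    length (concat (tabulate nb))  ≡⟨ length-concat-map _,_ nb ⟨
    length arcs                    ≤⟨ unique-⊆-length arcs-unique arcs⊆ ⟩
    length (edges ++ map swap edges) ≡⟨ List.length-++ edges ⟩
    ∣E∣ G + length (map swap edges) ≡⟨ cong (∣E∣ G ℕ.+_) (List.length-map swap edges) ⟩
    ∣E∣ G + ∣E∣ G ∎
    where
    open ℕ.≤-Reasoning
    edge? = λ ((u , v) : Fin n × Fin n) → u Fin.<? v ×-dec adj? u v
    edges = filter edge? (cartesianProduct (allFin n) (allFin n))
    arcsFrom : Fin n → List (Fin n × Fin n)
    arcsFrom v = map (v ,_) (nb v)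
    arcs = concat (tabulate arcsFrom)
    arcs-unique : Unique arcs
    arcs-unique = AllPairs.concat⁺
      (All.tabulate⁺ λ v → Unique.map⁺ (λ { refl → refl }) (unique v))
      (AllPairs.tabulate⁺ λ {v} {w} v≢w → All.tabulate λ x∈ → All.tabulate λ y∈ x≡y →
        let _ , _ , x≡ = ∈-map⁻ (v ,_) x∈
            _ , _ , y≡ = ∈-map⁻ (w ,_) y∈
        in v≢w (cong proj₁ (trans (sym x≡) (trans x≡y y≡))))
    edge∈ : ∀ {u v} → u Fin.< v → Adj u v → (u , v) ∈ edges
    edge∈ {u} {v} u<v uv = ∈-filter⁺ edge? (∈-cartesianProduct⁺ (∈-allFin u) (∈-allFin v)) (u<v , uv)
    arcs⊆ : arcs ⊆ edges ++ map swap edges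
    arcs⊆ a∈ with _ , a∈′ , from∈ ← ∈-concat⁻′ (tabulate arcsFrom) a∈
      with v , refl ← ∈-tabulate⁻ from∈
      with w , w∈ , refl ← ∈-map⁻ (v ,_) a∈′
      with Fin.<-cmp v w
    ... | tri< v<w _ _  = ∈-++⁺ˡ (edge∈ v<w (adj w∈))
    ... | tri≈ _ v≡w _  = contradiction (adj w∈) (adj-irrefl v≡w)
    ... | tri> _ _ w<v  = ∈-++⁺ʳ edges (∈-map⁺ swap (edge∈ w<v (adj-sym (adj w∈))))

-- Running times

data Post (R : Bool → Set) (Q : State → Set) : Outcome → Set where
  running  : ∀ {s} → Q s → Post R Q (running s)
  returned : ∀ {b} → R b → Post R Q (returned b)

-- A total-correctness triple with a time bound: `Q` is for reaching the end, `R` for a `RETURN`,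
-- which abandons the rest of the program. The time is only bounded above, so that branches can be
-- merged and early returns absorbed.
record Runs (P : Program) (s : State) (R : Bool → Set) (Q : State → Set) (bound : ℕ) : Set where
  constructor runs
  field
    {outcome} : Outcome
    {time}    : ℕ
    run       : P , s ⇓ outcome , time
    time≤     : time ≤ bound
    post      : Post R Q outcome

module _ {R : Bool → Set} {Q : State → Set} where

  assigning : ∀ {x e s} → Q (setScalar x (eval s e) s) → Runs (x := e) s R Q (suc (expCost e))
  assigning q = runs assign ℕ.≤-refl (running q)

  storing : ∀ {a e f s} → Q (setCell a (eval s e) (eval s f) s) →
            Runs (a ⟦ e ⟧:= f) s R Q (suc (expCost e + expCost f))
  storing q = runs store ℕ.≤-refl (running q)

  skipping : ∀ {s} → Q s → Runs skip s R Q 1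
  skipping q = runs skip ℕ.≤-refl (running q)

  returning : ∀ {b s} → R b → Runs (RETURN b) s R Q 1
  returning r = runs ret ℕ.≤-refl (returned r)

  relax : ∀ {P s b c} → b ≤ c → Runs P s R Q b → Runs P s R Q c
  relax b≤c (runs r t≤b p) = runs r (ℕ.≤-trans t≤b b≤c) p

imply : ∀ {P s R Q Q′ b} → (∀ {s′} → Q s′ → Q′ s′) → Runs P s R Q b → Runs P s R Q′ b
imply f (runs r t≤b (running q))  = runs r t≤b (running (f q))
imply f (runs r t≤b (returned p)) = runs r t≤b (returned p)

infixr 5 _then_
_then_ : ∀ {P P′ s R Q Q′ b b′} → Runs P s R Q b → (∀ {s′} → Q s′ → Runs P′ s′ R Q′ b′) →
         Runs (P ⨾ P′) s R Q′ (b + b′)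
runs r t≤b (returned p) then _ = runs (seqRet r) (ℕ.≤-trans t≤b (ℕ.m≤m+n _ _)) (returned p)
runs r t≤b (running q)  then k with runs r′ t′≤b′ p ← k q = runs (seq r r′) (ℕ.+-mono-≤ t≤b t′≤b′) p

Holds : State → Test → Set
Holds s (e == f) = eval s e ≡ eval s f
Holds s (e ≤ᵉ f) = eval s e ℤ.≤ eval s f
Holds s (e <ᵉ f) = eval s e ℤ.< eval s f

holds? : ∀ s c → Dec (Holds s c)
holds? s (e == f) = eval s e ℤ.≟ eval s f
holds? s (e ≤ᵉ f) = eval s e ℤ.≤? eval s f
holds? s (e <ᵉ f) = eval s e ℤ.<? eval s f

test-holds? : ∀ s c → test s c ≡ ⌊ holds? s c ⌋
test-holds? s (e == f) = refl
test-holds? s (e ≤ᵉ f) = refl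
test-holds? s (e <ᵉ f) = refl

branching : ∀ {c P P′ s R Q b b′} →
            (Holds s c → Runs P s R Q b) → (¬ Holds s c → Runs P′ s R Q b′) →
            Runs (IF c THEN P ELSE P′) s R Q (testCost c + (b ℕ.⊔ b′))
branching {c} {s = s} {b = b} {b′} yes-case no-case with holds? s c | test-holds? s c
... | yes h | eq with runs r t≤b p ← yes-case h =
  runs (ifTrue eq r) (ℕ.+-monoʳ-≤ (testCost c) (ℕ.≤-trans t≤b (ℕ.m≤m⊔n b b′))) p
... | no ¬h | eq with runs r t≤b p ← no-case ¬h =
  runs (ifFalse eq r) (ℕ.+-monoʳ-≤ (testCost c) (ℕ.≤-trans t≤b (ℕ.m≤n⊔m b b′))) p

test-true : ∀ s c → Holds s c → test s c ≡ true
test-true s c h with holds? s c | test-holds? s c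
... | yes _ | eq = eq
... | no ¬h | _  = contradiction h ¬h

test-false : ∀ s c → ¬ Holds s c → test s c ≡ false
test-false s c ¬h with holds? s c | test-holds? s c
... | yes h | _  = contradiction h ¬h
... | no _  | eq = eq

stopping : ∀ {c P s R Q} → ¬ Holds s c → Q s → Runs (WHILE c DO P) s R Q (testCost c)
stopping {c} {s = s} ¬h q = runs (stop (test-false s c ¬h)) ℕ.≤-refl (running q)

iterating : ∀ {c P s R Q Q′ b b′} → Holds s c → Runs P s R Q b →
            (∀ {s′} → Q s′ → Runs (WHILE c DO P) s′ R Q′ b′) →
            Runs (WHILE c DO P) s R Q′ (testCost c + b + b′)
iterating {c} {s = s} {b = b} {b′} h (runs r t≤b (returned p)) _ =
  runs (loopRet (test-true s c h) r)
       (ℕ.≤-trans (ℕ.+-monoʳ-≤ (testCost c) t≤b) (ℕ.m≤m+n (testCost c + b) b′)) (returned p)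
iterating {c} {s = s} h (runs r t≤b (running q)) k with runs r′ t′≤b′ p ← k q =
  runs (loop (test-true s c h) r r′) (ℕ.+-mono-≤ (ℕ.+-monoʳ-≤ (testCost c) t≤b) t′≤b′) p

-- The rule for loops with one round per element of `Fin n`. `Inv` is indexed by the number of
-- completed rounds; the induction drops the first round and shifts this index.
counting : ∀ {c P R n} (Inv : ℕ → State → Set) (cost : Fin n → ℕ) →
           (∀ {k} s → Inv k s → Holds s c ⇔ k < n) →
           (∀ v {s} → Inv (toℕ v) s → Runs P s R (Inv (suc (toℕ v))) (cost v)) →
           ∀ {s} → Inv 0 s →
           Runs (WHILE c DO P) s R (Inv n) (sum (tabulate λ v → testCost c + cost v) + testCost c)
counting {n = zero}  Inv cost guard body inv = stopping (λ h → case guard _ inv .to h of λ ()) inv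
counting {c} {n = suc n} Inv cost guard body inv =
  relax (ℕ.≤-reflexive (sym (ℕ.+-assoc (testCost c + cost Fin.zero) _ _)))
    (iterating (guard _ inv .from (s≤s z≤n)) (body Fin.zero inv)
      (counting (Inv ∘ suc) (cost ∘ Fin.suc)
        (λ s i → mk⇔ (ℕ.≤-pred ∘ guard s i .to) (guard s i .from ∘ s≤s)) (body ∘ Fin.suc)))

counting-const : ∀ {c P R n} (Inv : ℕ → State → Set) b →
           (∀ {k} s → Inv k s → Holds s c ⇔ k < n) →
           (∀ (v : Fin n) {s} → Inv (toℕ v) s → Runs P s R (Inv (suc (toℕ v))) b) →
           ∀ {s} → Inv 0 s →
           Runs (WHILE c DO P) s R (Inv n) ((testCost c + b) * n + testCost c)
counting-const {c} {n = n} Inv b guard body inv =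
  relax (ℕ.≤-reflexive (cong (_+ testCost c) (sum-const n (testCost c + b))))
    (counting Inv (λ _ → b) guard body inv)
  where
  sum-const : ∀ n a → sum (tabulate {n = n} λ _ → a) ≡ a * n
  sum-const zero    a = sym (ℕ.*-zeroʳ a)
  sum-const (suc n) a = trans (cong (a ℕ.+_) (sum-const n a)) (sym (ℕ.*-suc a n))

-- The offset `a` is 1 for the loop of `GEN-check`, which starts at 2, and 0 for the loops that
-- start at 1.
up-to-guard : ∀ s {a k n} → scalar s I ≡ + (a + k) → scalar s N ≡ + (a + n) →
              Holds s (var I ≤ᵉ var N) ⇔ k ≤ n
up-to-guard s {a} {k} {n} i≡ n≡ = mk⇔
  (λ h → ℕ.+-cancelˡ-≤ a k n (ℤ.drop‿+≤+ (subst₂ ℤ._≤_ i≡ n≡ h)))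
  (λ k≤n → subst₂ ℤ._≤_ (sym i≡) (sym n≡) (ℤ.+≤+ (ℕ.+-monoʳ-≤ a k≤n)))

-- Decision problems and the scan of `GEN-check`

Answers : Set → Bool → Set
Answers A b = b ≡ true ⇔ A

answers-yes : ∀ {A} → A → Answers A true
answers-yes a = mk⇔ (λ _ → a) (λ _ → refl)

answers-no : ∀ {A} → ¬ A → Answers A false
answers-no ¬a = mk⇔ (λ ()) (λ a → contradiction a ¬a)

decides : ∀ {P s A B b c size} → A ⇔ B → Runs P s (Answers B) (λ _ → ⊥) b →
          (1 ≤ size → b ≤ c * size) → Decides P s A c size
decides A⇔B (runs r t≤b (returned p)) b≤ = record
  { run     = r
  ; correct = mk⇔ (A⇔B .from ∘ p .to) (p .from ∘ A⇔B .to)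
  ; bound   = λ 1≤size → ℕ.≤-trans t≤b (b≤ 1≤size)
  }

-- The state of GEN-check once the positions up to k (from 0) are scanned: j is
-- the last of them with no left neighbour, and there was no reason to answer NO.
record Scanned {m} (L : Fin (suc m) → ℤ) (i k : ℕ) (s : State) : Set where
  constructor scanned
  field
    size≡   : scalar s N ≡ + suc m
    index≡  : scalar s I ≡ + i
    ln≡     : ∀ v → array s LN (num v) ≡ L v
    j       : Fin (suc m)
    start≡  : scalar s J ≡ num j
    j-start : L j ≡ -1ℤ
    j≤k     : toℕ j ≤ k
    latest  : ∀ b → toℕ b ≤ k → L b ≡ -1ℤ → toℕ b ≤ toℕ j
    valid   : ∀ b c → toℕ c ≤ k → b Fin.< c → L b ≡ -1ℤ → L c ≢ -1ℤ → num b ℤ.≤ L c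

-- Round `v` treats the position `Fin.suc v`, which is `2 + toℕ v` when counted from 1, because the
-- first position is never tested.
GEN-check-body : ∀ {m} {L : Fin (suc m) → ℤ} (v : Fin m) {s} → Scanned L (2 + toℕ v) (toℕ v) s →
  Runs (IF LN ⟦ var I ⟧ == lit -1ℤ
          THEN J := var I
          ELSE IF LN ⟦ var I ⟧ <ᵉ var J THEN RETURN false ELSE skip ⨾
        I := var I ⊕ 1ℤ)
       s (Answers (Accepts L)) (Scanned L (3 + toℕ v) (suc (toℕ v))) 12
GEN-check-body {L = L} v {s} (scanned size≡ index≡ ln≡ j start≡ j-start j≤k latest valid) =
  branching {Q = Scanned L (2 + toℕ v) (suc (toℕ v))}
    -- The new position becomes the latest start. It adds no pair to `valid`, its own value being
    -- -1.
    (λ h → let Li = trans (sym lni) h in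
      assigning (scanned size≡ index≡ ln≡ i index≡ Li ℕ.≤-refl (λ b b≤i _ → b≤i)
        (λ b c c≤i b<c lnb lnc → valid′ b c c≤i b<c lnb lnc λ { refl → contradiction Li lnc })))
    (λ ¬h → branching
      -- The pair of the start `j` and the position `i` refutes `Accepts`.
      (λ h → let Li<j = subst₂ ℤ._<_ lni start≡ h in
        returning (answers-no λ accepts → ℤ.<⇒≱ Li<j (accepts j i (s≤s j≤k) j-start (¬h ∘ trans lni))))
      (λ ¬h′ → skipping (scanned size≡ index≡ ln≡ j start≡ j-start (ℕ.m≤n⇒m≤1+n j≤k)
        (λ b b≤i lnb → earlier {b} (λ { refl → contradiction (trans lni lnb) ¬h }) b≤i
          λ b≤v → latest b b≤v lnb)
        -- Only `c = i` is new. Every start before `i` lies at or before the latest start `j`, so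
        -- the one comparison with `j` settles all of them.
        (λ b c c≤i b<c lnb lnc → valid′ b c c≤i b<c lnb lnc λ { refl →
          ℤ.≤-trans (ℤ.+≤+ (s≤s (latest b (ℕ.≤-pred b<c) lnb)))
                    (subst₂ ℤ._≤_ start≡ lni (ℤ.≮⇒≥ ¬h′)) }))))
  then λ (scanned size≡ index≡ ln≡ j start≡ j-start j≤k latest valid) →
  assigning (scanned size≡ (trans (cong (ℤ._+ 1ℤ) index≡) (cong +_ (ℕ.+-comm (2 + toℕ v) 1)))
    ln≡ j start≡ j-start j≤k latest valid)
  where
  i = Fin.suc v
  lni : array s LN (scalar s I) ≡ L i
  lni = trans (cong (array s LN) index≡) (ln≡ i)
  earlier : ∀ {b} {A : Set} → (b ≡ i → A) → toℕ b ≤ toℕ i → (toℕ b ≤ toℕ v → A) → A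
  earlier b≡i b≤i b≤v with ℕ.m≤n⇒m<n∨m≡n b≤i
  ... | inj₁ b<i   = b≤v (ℕ.≤-pred b<i)
  ... | inj₂ eq = b≡i (Fin.toℕ-injective eq)
  valid′ : ∀ b c → toℕ c ≤ toℕ i → b Fin.< c → L b ≡ -1ℤ → L c ≢ -1ℤ →
           (c ≡ i → num b ℤ.≤ L c) → num b ℤ.≤ L c
  valid′ b c c≤i b<c lnb lnc c≡i = earlier c≡i c≤i λ c≤v → valid b c c≤v b<c lnb lnc

-- The first position has value -1, so `J = 1` is a correct initial start. For `n = 0` there is no
-- such position to serve as `j` in `Scanned`, and the loop is not entered.
GEN-check-runs : ∀ {n} {L : Fin n → ℤ} {s} → (∀ v → toℕ v ≡ 0 → L v ≡ -1ℤ) → scalar s N ≡ + n →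
                 (∀ v → array s LN (num v) ≡ L v) →
                 Runs GEN-check s (Answers (Accepts L)) (λ _ → ⊥) (15 * n + 8)
GEN-check-runs {zero} {L} _ size≡ ln≡ =
  assigning {Q = λ s → scalar s N ≡ 0ℤ} size≡ then λ size≡ →
  assigning {Q = λ s → scalar s I ≡ + 2 × scalar s N ≡ 0ℤ} (refl , size≡) then λ (index≡ , size≡) →
  stopping {Q = λ _ → Accepts L} (λ h → case subst₂ ℤ._≤_ index≡ size≡ h of λ { (ℤ.+≤+ ()) }) (λ ())
  then λ accepts →
  returning (answers-yes accepts)
GEN-check-runs {suc m} {L} first-ln≡ size≡ ln≡ =
  relax bound
    (assigning {Q = λ s → scalar s N ≡ + suc m × scalar s J ≡ 1ℤ × (∀ v → array s LN (num v) ≡ L v)}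
       (size≡ , refl , ln≡) then λ (size≡ , start≡ , ln≡) →
     assigning {Q = Scanned L 2 0}
       (scanned size≡ refl ln≡ Fin.zero start≡ (first-ln≡ Fin.zero refl) z≤n (λ b b≤0 _ → b≤0)
         (λ b c c≤0 b<c → contradiction (ℕ.<-≤-trans b<c c≤0) λ ())) then λ inv →
     counting-const (λ k → Scanned L (2 + k) k) 12
       (λ s inv → up-to-guard s {1} (Scanned.index≡ inv) (Scanned.size≡ inv)) GEN-check-body inv
     then λ inv →
     returning (answers-yes λ b c → Scanned.valid inv b c (Fin.toℕ≤pred[n] c)))
  where
  open ℕ.≤-Reasoning
  bound : 4 + (15 * m + 3 + 1) ≤ 15 * suc m + 8
  bound = begin
    4 + (15 * m + 3 + 1)  ≡⟨ cong (λ x → 4 + x) (ℕ.+-assoc (15 * m) 3 1) ⟩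
    4 + (15 * m + 4)      ≡⟨ ℕ.+-comm 4 (15 * m + 4) ⟩
    15 * m + 4 + 4        ≡⟨ ℕ.+-assoc (15 * m) 4 4 ⟩
    15 * m + 8            ≤⟨ ℕ.+-monoˡ-≤ 8 (ℕ.*-monoʳ-≤ 15 (ℕ.n≤1+n m)) ⟩
    15 * suc m + 8        ∎

-- Deciding from adjacency lists

cell-same : ∀ {s} a {i j k} → i ≡ j → array (setCell a j k s) a i ≡ k
cell-same a {i} {j} i≡j with a ℕ.≟ a | i ℤ.≟ j
... | yes _ | yes _ = refl
... | yes _ | no ¬p = contradiction i≡j ¬p
... | no ¬p | _     = contradiction refl ¬p

cell-other : ∀ {s} a {i j k} → i ≢ j → array (setCell a j k s) a i ≡ array s a i
cell-other a {i} {j} i≢j with a ℕ.≟ a | i ℤ.≟ j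
... | yes _ | yes p = contradiction p i≢j
... | yes _ | no _  = refl
... | no _  | _     = refl

num-injective : ∀ {n} {i j : Fin n} → num i ≡ num j → i ≡ j
num-injective eq = Fin.toℕ-injective (ℕ.suc-injective (ℤ.+-injective eq))

-- `Linked` is indexed by the whole state, so it has to be transported along every assignment, even
-- one that leaves the lists alone.
Linked-cong : ∀ {n s s′ p} {vs : List (Fin n)} →
              (∀ i → array s VERT i ≡ array s′ VERT i) → (∀ i → array s NEXT i ≡ array s′ NEXT i) →
              Linked s p vs → Linked s′ p vs
Linked-cong vert next [] = []
Linked-cong {s′ = s′} vert next (_∷_ {p} (p≢0 , v≡) l) =
  (p≢0 , trans (sym (vert p)) v≡) ∷ subst (λ q → Linked s′ q _) (next p) (Linked-cong vert next l)

pattern PTR  = 3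
pattern MIN  = 4
pattern MORE = 5

pattern POS = 5

invert : Program
invert =
  I := lit 1ℤ ⨾
  WHILE var I ≤ᵉ var N DO (
    POS ⟦ ORDER ⟦ var I ⟧ ⟧:= var I ⨾
    I := var I ⊕ 1ℤ)

-- There is no test for inequality, hence the flag.
testPointer : Program
testPointer = IF var PTR == lit 0ℤ THEN MORE := lit 0ℤ ELSE MORE := lit 1ℤ

minimise : Program
minimise =
  WHILE var MORE == lit 1ℤ DO (
    IF POS ⟦ VERT ⟦ var PTR ⟧ ⟧ <ᵉ var MIN
      THEN MIN := POS ⟦ VERT ⟦ var PTR ⟧ ⟧
      ELSE skip ⨾
    PTR := NEXT ⟦ var PTR ⟧ ⨾
    testPointer)

-- MIN starts with the position of the vertex itself, and keeps this value
-- exactly if there is no left neighbour.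
computeLn : Program
computeLn =
  I := lit 1ℤ ⨾
  WHILE var I ≤ᵉ var N DO (
    MIN := POS ⟦ var I ⟧ ⨾
    PTR := HEAD ⟦ var I ⟧ ⨾
    testPointer ⨾
    minimise ⨾
    IF var MIN == POS ⟦ var I ⟧
      THEN LN ⟦ POS ⟦ var I ⟧ ⟧:= lit -1ℤ
      ELSE LN ⟦ POS ⟦ var I ⟧ ⟧:= var MIN ⨾
    I := var I ⊕ 1ℤ)

GEN-decide : Program
GEN-decide = invert ⨾ computeLn ⨾ GEN-check

-- The numerals are the costs of the program parts, as the rules for Runs add them up.
module _ where
  open +-*-Solver

  invert-cost : ∀ n → 2 + (10 * n + 3) ≡ 10 * n + 5
  invert-cost = solve 1 (λ n → con 2 :+ (con 10 :* n :+ con 3) := con 10 :* n :+ con 5) refl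

  minimise-cost : ∀ l → 20 + (3 + 20 * l) ≡ 3 + 20 * suc l
  minimise-cost = solve 1 (λ l →
    con 20 :+ (con 3 :+ con 20 :* l) := con 3 :+ con 20 :* (con 1 :+ l)) refl

  vertex-cost : ∀ l → 3 + (3 + (5 + (3 + 20 * l + (8 + 3)))) ≡ 25 + 20 * l
  vertex-cost = solve 1 (λ l →
    con 3 :+ (con 3 :+ (con 5 :+ (con 3 :+ con 20 :* l :+ (con 8 :+ con 3))))
      := con 25 :+ con 20 :* l) refl

  check-cost : ∀ {n} → 1 ≤ n → 15 * n + 8 ≤ 23 * n
  check-cost {n} 1≤n = begin
    15 * n + 8      ≤⟨ ℕ.+-monoʳ-≤ (15 * n) (ℕ.*-monoʳ-≤ 8 1≤n) ⟩
    15 * n + 8 * n  ≡⟨ ℕ.*-distribʳ-+ n 15 8 ⟨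
    23 * n          ∎
    where open ℕ.≤-Reasoning

  total-cost : ∀ n d →
    10 * n + 5 + (2 + (28 * n + 20 * d + 3) + (15 * n + 8)) ≡ 18 + 53 * n + 20 * d
  total-cost = solve 2 (λ n d →
    con 10 :* n :+ con 5 :+ (con 2 :+ (con 28 :* n :+ con 20 :* d :+ con 3) :+ (con 15 :* n :+ con 8))
      := con 18 :+ con 53 :* n :+ con 20 :* d) refl

  linear-cost : ∀ {n m d} → d ≤ m + m → 1 ≤ n + m → 18 + 53 * n + 20 * d ≤ 111 * (n + m)
  linear-cost {n} {m} {d} d≤ 1≤ = begin
    18 + 53 * n + 20 * d
      ≤⟨ ℕ.+-mono-≤ (ℕ.+-mono-≤ (ℕ.*-monoʳ-≤ 18 1≤) (ℕ.*-monoʳ-≤ 53 (ℕ.m≤m+n n m)))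
                    (ℕ.*-monoʳ-≤ 20 (ℕ.≤-trans d≤ (ℕ.+-mono-≤ (ℕ.m≤n+m m n) (ℕ.m≤n+m m n)))) ⟩
    18 * (n + m) + 53 * (n + m) + 20 * (n + m + (n + m))
      ≡⟨ solve 1 (λ x → con 18 :* x :+ con 53 :* x :+ con 20 :* (x :+ x) := con 111 :* x)
           refl (n + m) ⟩
    111 * (n + m) ∎
    where open ℕ.≤-Reasoning

-- Invariants of the loops on adjacency lists

module _ {n} (G : Graph n) (σ : Ordering n)
         (nb : Fin n → List (Fin n)) (nb⇔ : ∀ v w → w ∈ nb v ⇔ Graph.Adj G v w) where
  open Graph G

  private
    position : Fin n → Fin n
    position v = σ ⟨$⟩ˡ v

    position-injective : ∀ {u v} → position u ≡ position v → u ≡ v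
    position-injective = pos-injective G σ ∘ cong toℕ

  Links : State → Set
  Links s = ∀ v → Linked s (array s HEAD (num v)) (nb v)

  record Inverting (i k : ℕ) (s : State) : Set where
    constructor inverting
    field
      size≡  : scalar s N ≡ + n
      index≡ : scalar s I ≡ + i
      links  : Links s
      order≡ : HoldsOrdering σ s
      pos≡   : ∀ v → toℕ (position v) < k → array s POS (num v) ≡ num (position v)

  suc-index : ∀ {x i} → x ≡ + i → x ℤ.+ 1ℤ ≡ + suc i
  suc-index {i = i} refl = cong +_ (ℕ.+-comm i 1)

  invert-runs : ∀ {R s} → scalar s N ≡ + n → Links s → HoldsOrdering σ s →
                Runs invert s R (Inverting (suc n) n) (10 * n + 5)
  invert-runs {R} size≡ links order≡ =
    relax (ℕ.≤-reflexive (invert-cost n))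
      (assigning {Q = Inverting 1 0}
         (inverting size≡ refl (Linked-cong (λ _ → refl) (λ _ → refl) ∘ links) order≡ λ _ ()) then
       counting-const (λ k → Inverting (suc k) k) 7
         (λ s inv → up-to-guard s {0} (Inverting.index≡ inv) (Inverting.size≡ inv)) body)
    where
    body : ∀ (i : Fin n) {s} → Inverting (suc (toℕ i)) (toℕ i) s →
           Runs (POS ⟦ ORDER ⟦ var I ⟧ ⟧:= var I ⨾ I := var I ⊕ 1ℤ) s R
                (Inverting (2 + toℕ i) (suc (toℕ i))) 7
    body i {s} (inverting size≡ index≡ links order≡ pos≡) =
      storing {Q = Inverting (suc (toℕ i)) (suc (toℕ i))}
        (inverting size≡ index≡ (Linked-cong (λ _ → refl) (λ _ → refl) ∘ links) order≡ pos≡′) then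
      λ (inverting size≡ index≡ links order≡ pos≡) →
      assigning (inverting size≡ (suc-index index≡)
                           (Linked-cong (λ _ → refl) (λ _ → refl) ∘ links) order≡ pos≡)
      where
      key = array s ORDER (scalar s I)
      key≡ : key ≡ num (σ ⟨$⟩ʳ i)
      key≡ = trans (cong (array s ORDER) index≡) (order≡ i)
      pos≡′ : ∀ v → toℕ (position v) < suc (toℕ i) →
              array (setCell POS key (scalar s I) s) POS (num v) ≡ num (position v)
      pos≡′ v v≤i with position v Fin.≟ i
      ... | yes refl =
        trans (cell-same {s} POS (trans (cong num (sym (inverseʳ σ))) (sym key≡))) index≡
      ... | no v≢i =
        trans (cell-other {s} POS λ eq →
                 v≢i (trans (cong position (num-injective (trans eq key≡))) (inverseˡ σ)))
              (pos≡ v (ℕ.≤∧≢⇒< (ℕ.≤-pred v≤i) (v≢i ∘ Fin.toℕ-injective)))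

  flag : List (Fin n) → ℤ
  flag []      = 0ℤ
  flag (_ ∷ _) = 1ℤ

  -- `s₀` is the state at the start of the round for one vertex. Walking along its list writes no
  -- array cell, so the links can be read in `s₀` throughout. The flag `MORE` is left to `Walk`, as
  -- it is out of date until `testPointer` has run.
  record Walking (s₀ : State) (m : Fin n) (ws : List (Fin n)) (s : State) : Set where
    constructor walking
    field
      array≡ : array s ≡ array s₀
      size≡  : scalar s N ≡ scalar s₀ N
      index≡ : scalar s I ≡ scalar s₀ I
      min≡   : scalar s MIN ≡ num m
      link   : Linked s₀ (scalar s PTR) ws

  Walk : State → Fin n → List (Fin n) → State → Set
  Walk s₀ m ws s = Walking s₀ m ws s × scalar s MORE ≡ flag ws

  testPointer-runs : ∀ {R s₀ m ws s} → Walking s₀ m ws s → Runs testPointer s R (Walk s₀ m ws) 5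
  testPointer-runs (walking array≡ size≡ index≡ min≡ link) =
    branching (λ p≡0 → assigning (walking array≡ size≡ index≡ min≡ link , sym (nil p≡0 link)))
              (λ p≢0 → assigning (walking array≡ size≡ index≡ min≡ link , sym (cons p≢0 link)))
    where
    nil : ∀ {s p ws} → p ≡ 0ℤ → Linked s p ws → flag ws ≡ 0ℤ
    nil p≡0 []              = refl
    nil p≡0 ((p≢0 , _) ∷ _) = contradiction p≡0 p≢0
    cons : ∀ {s p ws} → p ≢ 0ℤ → Linked s p ws → flag ws ≡ 1ℤ
    cons p≢0 []      = contradiction refl p≢0
    cons p≢0 (_ ∷ _) = refl

  record Minimum (m : Fin n) (ws : List (Fin n)) (m′ : Fin n) : Set where
    constructor minimum
    field
      ≤start   : m′ Fin.≤ m
      ≤members : ∀ {w} → w ∈ ws → m′ Fin.≤ position w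
      attained : m′ ≡ m ⊎ ∃ λ w → w ∈ ws × m′ ≡ position w

  minimum-∷ : ∀ {m v m₁ vs m′} → Minimum m (v ∷ []) m₁ → Minimum m₁ vs m′ → Minimum m (v ∷ vs) m′
  minimum-∷ {m} {v} {m₁} {vs} {m′} (minimum m₁≤m m₁≤v att₁) (minimum m′≤m₁ m′≤vs att′) =
    minimum (ℕ.≤-trans m′≤m₁ m₁≤m) ≤all (attained att′ att₁)
    where
    ≤all : ∀ {w} → w ∈ v ∷ vs → m′ Fin.≤ position w
    ≤all (here refl) = ℕ.≤-trans m′≤m₁ (m₁≤v (here refl))
    ≤all (there w∈)  = m′≤vs w∈
    attained : m′ ≡ m₁ ⊎ (∃ λ w → w ∈ vs × m′ ≡ position w) →
               m₁ ≡ m ⊎ (∃ λ w → w ∈ v ∷ [] × m₁ ≡ position w) →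
               m′ ≡ m ⊎ (∃ λ w → w ∈ v ∷ vs × m′ ≡ position w)
    attained (inj₂ (w , w∈ , eq)) _ = inj₂ (w , there w∈ , eq)
    attained (inj₁ refl) (inj₁ eq)  = inj₁ eq
    attained (inj₁ refl) (inj₂ (w , here refl , eq)) = inj₂ (w , here refl , eq)

  minimise-runs : ∀ {R s₀ m s} ws → (∀ v → array s₀ POS (num v) ≡ num (position v)) →
                  Walk s₀ m ws s →
                  Runs minimise s R (λ s → ∃ λ m′ → Walking s₀ m′ [] s × Minimum m ws m′)
                       (3 + 20 * length ws)
  minimise-runs {m = m} [] pos≡ (walk , more≡) =
    stopping (λ h → case trans (sym more≡) h of λ ())
             (m , walk , minimum ℕ.≤-refl (λ ()) (inj₁ refl))
  minimise-runs {R} {s₀} {m} {s} (v ∷ vs) pos≡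
                (walking array≡ size≡ index≡ min≡ link@((p≢0 , vert≡) ∷ _) , more≡) =
    relax (ℕ.≤-reflexive (minimise-cost (length vs)))
    (iterating {Q = λ s → ∃ λ m₁ → Walk s₀ m₁ vs s × Minimum m (v ∷ []) m₁} more≡
      ((branching {Q = λ s → ∃ λ m₁ → Walking s₀ m₁ (v ∷ vs) s × Minimum m (v ∷ []) m₁}
         (λ h → assigning (position v , walking array≡ size≡ index≡ posv≡ link ,
           minimum (ℕ.<⇒≤ (ℕ.≤-pred (ℤ.drop‿+<+ (subst₂ ℤ._<_ posv≡ min≡ h))))
                   (λ { (here refl) → ℕ.≤-refl }) (inj₂ (v , here refl , refl))))
         (λ ¬h → skipping (m , walking array≡ size≡ index≡ min≡ link ,
           minimum ℕ.≤-refl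
                   (λ { (here refl) → ℕ.≤-pred (ℤ.drop‿+≤+ (subst₂ ℤ._≤_ min≡ posv≡ (ℤ.≮⇒≥ ¬h))) })
                   (inj₁ refl))))
       then λ (m₁ , walk , min) →
       (assigning {Q = Walking s₀ m₁ vs} (advance walk)
        then λ walk → imply (λ walk → m₁ , walk , min) (testPointer-runs walk)))
      λ (m₁ , walk , min) →
        imply (λ (m′ , walk′ , min′) → m′ , walk′ , minimum-∷ min min′) (minimise-runs vs pos≡ walk))
    where
    posv≡ : array s POS (array s VERT (scalar s PTR)) ≡ num (position v)
    posv≡ = trans (cong (λ a → a POS (a VERT (scalar s PTR))) array≡)
                  (trans (cong (array s₀ POS) vert≡) (pos≡ v))
    advance : ∀ {m₁ s} → Walking s₀ m₁ (v ∷ vs) s →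
              Walking s₀ m₁ vs (setScalar PTR (array s NEXT (scalar s PTR)) s)
    advance (walking array≡ size≡ index≡ min≡ (_ ∷ link)) =
      walking array≡ size≡ index≡ min≡ (subst (λ a → Linked s₀ (a NEXT _) vs) (sym array≡) link)

  -- The start value caps the minimum at the position of `v`. Neighbours to the right thus have no
  -- influence, and any other value is attained by a left neighbour.
  Minimum⇒IsLn : ∀ {v m} → Minimum (position v) (nb v) m →
                 (m ≡ position v → IsLn G σ (position v) -1ℤ) ×
                 (m ≢ position v → IsLn G σ (position v) (num m))
  Minimum⇒IsLn {v} {m} (minimum m≤v m≤nb attained) = fresh , reached attained
    where
    member : ∀ {j} → LeftNeighbour G σ (position v) j → m Fin.≤ j
    member {j} (_ , vj) = subst (m Fin.≤_) (inverseˡ σ)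
      (m≤nb (nb⇔ v (σ ⟨$⟩ʳ j) .from (subst (λ u → Adj u _) (inverseʳ σ) vj)))
    fresh : m ≡ position v → IsLn G σ (position v) -1ℤ
    fresh refl = none refl λ j vj → ℕ.<⇒≱ (proj₁ vj) (member vj)
    reached : (m ≡ position v ⊎ ∃ λ w → w ∈ nb v × m ≡ position w) →
              m ≢ position v → IsLn G σ (position v) (num m)
    reached (inj₁ eq) m≢v = contradiction eq m≢v
    reached (inj₂ (w , w∈ , refl)) m≢v = least m refl
      (ℕ.≤∧≢⇒< m≤v (m≢v ∘ Fin.toℕ-injective) ,
       subst₂ Adj (sym (inverseʳ σ)) (sym (inverseʳ σ)) (nb⇔ v w .to w∈))
      λ k → member

  -- The loop goes through vertices, not positions: after `k` rounds the finished cells of `LN` are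
  -- those at the positions of the first `k` vertices.
  record Filling (i k : ℕ) (s : State) : Set where
    constructor filling
    field
      size≡  : scalar s N ≡ + n
      index≡ : scalar s I ≡ + i
      links  : Links s
      pos≡   : ∀ v → array s POS (num v) ≡ num (position v)
      ln≡    : ∀ v → toℕ v < k → array s LN (num (position v)) ≡ ln G σ (position v)

  fill-body : ∀ {R} v {s} → Filling (suc (toℕ v)) (toℕ v) s →
    Runs (MIN := POS ⟦ var I ⟧ ⨾
          PTR := HEAD ⟦ var I ⟧ ⨾
          testPointer ⨾
          minimise ⨾
          IF var MIN == POS ⟦ var I ⟧
            THEN LN ⟦ POS ⟦ var I ⟧ ⟧:= lit -1ℤ
            ELSE LN ⟦ POS ⟦ var I ⟧ ⟧:= var MIN ⨾
          I := var I ⊕ 1ℤ)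
         s R (Filling (2 + toℕ v) (suc (toℕ v))) (25 + 20 * length (nb v))
  fill-body v {s} (filling size≡ index≡ links pos≡ ln≡) =
    relax (ℕ.≤-reflexive (vertex-cost (length (nb v))))
    (assigning {Q = λ s′ → array s′ ≡ array s × scalar s′ N ≡ scalar s N ×
                            scalar s′ I ≡ scalar s I × scalar s′ MIN ≡ num (position v)}
       (refl , refl , refl , here-pos refl refl) then λ (array≡ , N≡ , I≡ , min≡) →
     assigning {Q = Walking s (position v) (nb v)}
       (walking array≡ N≡ I≡ min≡ (subst (λ p → Linked s p (nb v)) (sym (head≡ array≡ I≡)) (links v)))
     then λ walk →
     testPointer-runs walk then λ walk →
     minimise-runs (nb v) pos≡ walk then λ (m , walk , min) →
     branching {Q = Filling (suc (toℕ v)) (suc (toℕ v))}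
       (λ h → storing (stored walk (least-ln (proj₁ (Minimum⇒IsLn min) (num-injective
                (trans (sym (Walking.min≡ walk)) (trans h (own-position walk))))))))
       (λ ¬h → storing (stored walk (trans (Walking.min≡ walk) (least-ln (proj₂ (Minimum⇒IsLn min)
                λ { refl → ¬h (trans (Walking.min≡ walk) (sym (own-position walk))) })))))
     then λ (filling size≡ index≡ links pos≡ ln≡) →
     assigning (filling size≡ (suc-index index≡)
                        (Linked-cong (λ _ → refl) (λ _ → refl) ∘ links) pos≡ ln≡))
    where
    head≡ : ∀ {a i} → a ≡ array s → i ≡ scalar s I → a HEAD i ≡ array s HEAD (num v)
    head≡ array≡ I≡ =
      trans (cong-app (cong-app array≡ HEAD) _) (cong (array s HEAD) (trans I≡ index≡))
    here-pos : ∀ {a i} → a ≡ array s → i ≡ scalar s I → a POS i ≡ num (position v)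
    here-pos array≡ I≡ =
      trans (cong-app (cong-app array≡ POS) _) (trans (cong (array s POS) (trans I≡ index≡)) (pos≡ v))
    own-position : ∀ {m s′} → Walking s m [] s′ → array s′ POS (scalar s′ I) ≡ num (position v)
    own-position walk = here-pos (Walking.array≡ walk) (Walking.index≡ walk)
    least-ln : ∀ {x} → IsLn G σ (position v) x → x ≡ ln G σ (position v)
    least-ln is = IsLn-unique G σ is (ln-IsLn G σ _)
    stored : ∀ {m x s′} → Walking s m [] s′ → x ≡ ln G σ (position v) →
             Filling (suc (toℕ v)) (suc (toℕ v)) (setCell LN (array s′ POS (scalar s′ I)) x s′)
    stored {s′ = s′} (walking array≡ N≡ I≡ _ _) x≡ =
      filling (trans N≡ size≡) (trans I≡ index≡) links′
              (λ u → trans (cong-app (cong-app array≡ POS) _) (pos≡ u)) ln≡′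
      where
      key≡ = here-pos array≡ I≡
      links′ : ∀ u → Linked (setCell LN _ _ s′) (array s′ HEAD (num u)) (nb u)
      links′ u = Linked-cong
        (λ _ → cong-app (cong-app (sym array≡) VERT) _) (λ _ → cong-app (cong-app (sym array≡) NEXT) _)
        (subst (λ p → Linked s p (nb u)) (cong-app (cong-app (sym array≡) HEAD) _) (links u))
      ln≡′ : ∀ u → toℕ u < suc (toℕ v) →
             array (setCell LN (array s′ POS (scalar s′ I)) _ s′) LN (num (position u))
               ≡ ln G σ (position u)
      ln≡′ u u≤v with u Fin.≟ v
      ... | yes refl = trans (cell-same {s′} LN (sym key≡)) x≡
      -- Distinct vertices have distinct positions, so the cells filled in earlier rounds survive.
      ... | no u≢v = trans (cell-other {s′} LN λ eq →
                      u≢v (position-injective (num-injective (trans eq key≡))))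
        (trans (cong-app (cong-app array≡ LN) _) (ln≡ u (ℕ.≤∧≢⇒< (ℕ.≤-pred u≤v) (u≢v ∘ Fin.toℕ-injective))))

  computeLn-runs : ∀ {R s} → Inverting (suc n) n s →
                   Runs computeLn s R (Filling (suc n) n)
                        (2 + (28 * n + 20 * length (concat (tabulate nb)) + 3))
  computeLn-runs {R} (inverting size≡ _ links _ pos≡) =
    assigning {Q = Filling 1 0} (filling size≡ refl (Linked-cong (λ _ → refl) (λ _ → refl) ∘ links)
      (λ v → pos≡ v (Fin.toℕ<n (position v))) λ _ ()) then λ inv →
    relax (ℕ.≤-reflexive (cong (_+ 3) (sum-tabulate-affine nb 28 20)))
      (counting (λ k → Filling (suc k) k) (λ v → 25 + 20 * length (nb v))
        (λ s inv → up-to-guard s {0} (Filling.index≡ inv) (Filling.size≡ inv)) fill-body inv)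

first-ln : ∀ {n} (G : Graph n) (σ : Ordering n) v → toℕ v ≡ 0 → ln G σ v ≡ -1ℤ
first-ln G σ v v≡0 with ln-IsLn G σ v
... | none eq _ = eq
... | least j _ (j<v , _) _ = contradiction (subst (toℕ j <_) v≡0 j<v) λ ()

theorem10 : (∃ λ (c : ℕ) →
    ∀ {n} (G : Graph n) (σ : Ordering n) (s : State) →
    HoldsSize n s → HoldsLn G σ s →
    Decides GEN-check s (IsGENOrdering G σ) c n)
    ×
    (∃₂ λ (P : Program) (c : ℕ) →
    ∀ {n} (G : Graph n) (σ : Ordering n) (s : State) →
    HoldsSize n s → HoldsGraph G s → HoldsOrdering σ s →
    Decides P s (IsGENOrdering G σ) c (n + ∣E∣ G))
-- For `n` at least 1, `15 * n + 8` is at most `23 * n`. The constant 111 is 18 + 53 + 2 * 20, as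
-- each list entry costs 20 and there are at most two entries per edge.
theorem10 = (23 , check) , (GEN-decide , 111 , decide)
  where
  check : ∀ {n} (G : Graph n) (σ : Ordering n) (s : State) →
          HoldsSize n s → HoldsLn G σ s → Decides GEN-check s (IsGENOrdering G σ) 23 n
  check {n} G σ s size≡ ln≡ =
    decides (IsGENOrdering⇔Accepts G σ) (GEN-check-runs (first-ln G σ) size≡ ln≡) check-cost
  decide : ∀ {n} (G : Graph n) (σ : Ordering n) (s : State) →
           HoldsSize n s → HoldsGraph G s → HoldsOrdering σ s →
           Decides GEN-decide s (IsGENOrdering G σ) 111 (n + ∣E∣ G)
  decide {n} G σ s size≡ graph order≡ =
    decides (IsGENOrdering⇔Accepts G σ)
      (relax (ℕ.≤-reflexive (total-cost n (length (concat (tabulate nb)))))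
        (invert-runs G σ nb nb⇔ size≡ (proj₂ ∘ proj₂ ∘ proj₂ ∘ graph) order≡ then λ inv →
         computeLn-runs G σ nb nb⇔ inv then λ inv →
         GEN-check-runs (first-ln G σ) (Filling.size≡ inv) (ln-everywhere inv)))
      (linear-cost {n} (degree-sum≤ G nb (proj₁ ∘ proj₂ ∘ graph) (nb⇔ _ _ .to)))
    where
    nb = proj₁ ∘ graph
    nb⇔ = proj₁ ∘ proj₂ ∘ proj₂ ∘ graph
    ln-everywhere : ∀ {s} → Filling G σ nb nb⇔ (suc n) n s → HoldsLn G σ s
    -- Each position `i` has been filled in the round of the vertex standing there.
    ln-everywhere {s} inv i = subst (λ j → array s LN (num j) ≡ ln G σ j) (inverseˡ σ)
      (Filling.ln≡ inv (σ ⟨$⟩ʳ i) (Fin.toℕ<n _))
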